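{- $R^{\mathrm{KG}}_2(3,3)=9$ and $R^{\mathrm{KG}}_3(3,3)\le 13$.
   Context: The Kneser graph $\mathrm{KG}(n,r)$ has vertex set the $r$-element subsets of $[n]=\{1,\dots,n\}$, with two sets adjacent iff they are disjoint. The $r$-Kneser Ramsey number $R^{\mathrm{KG}}_r(s,t)$ is the minimum integer $n$ such that every red/blue edge-coloring of $\mathrm{KG}(n,r)$ contains a red $K_s$ (a set of $s$ pairwise adjacent vertices with all connecting edges red) or a blue $K_t$. In particular, $R^{\mathrm{KG}}_r(3,3)$ is the least $n$ such that every red/blue edge-coloring of $\mathrm{KG}(n,r)$ has a monochromatic triangle. -}

module Defs where

open import Data.Nat using (ℕ; _<_; _≤_)
open import Data.Bool using (Bool)
open import Data.Fin using (Fin)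
open import Data.Fin.Subset using (Subset; ∣_∣; _∈_; _∉_)
open import Data.Product using (Σ; ∃; ∃-syntax; _×_; proj₁)
open import Relation.Binary.PropositionalEquality using (_≡_)
open import Relation.Nullary using (¬_)

KVertex : ℕ → ℕ → Set
KVertex n r = Σ (Subset n) (λ s → ∣ s ∣ ≡ r)

Disjoint : ∀ {n} → Subset n → Subset n → Set
Disjoint {n} p q = ∀ (i : Fin n) → i ∈ p → i ∉ q

KAdj : ∀ {n r} → KVertex n r → KVertex n r → Set
KAdj u v = Disjoint (proj₁ u) (proj₁ v)

-- A red/blue edge-colouring of KG(n,r): a colour (Bool; say true = red,
-- false = blue) for each unordered pair, represented as a symmetric function
-- on ordered pairs of vertices (only its values on edges matter).
record EdgeColouring (n r : ℕ) : Set where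
  field
    colour    : KVertex n r → KVertex n r → Bool
    symmetric : ∀ u v → colour u v ≡ colour v u
open EdgeColouring public

MonoTriangle : ∀ {n r} → EdgeColouring n r → Bool → Set
MonoTriangle {n} {r} c b =
  Σ (KVertex n r) λ x → Σ (KVertex n r) λ y → Σ (KVertex n r) λ z →
    (KAdj x y × KAdj y z × KAdj x z) ×
    (colour c x y ≡ b × colour c y z ≡ b × colour c x z ≡ b)

Arrows33 : ℕ → ℕ → Set
Arrows33 r n = (c : EdgeColouring n r) → Σ Bool (MonoTriangle c)

KneserRamsey33≡ : ℕ → ℕ → Set
KneserRamsey33≡ r m = Arrows33 r m × (∀ n → n < m → ¬ Arrows33 r n)

-- R^KG_r(3,3) ≤ m : the least n with Arrows33 r n exists and is ≤ m.
KneserRamsey33≤ : ℕ → ℕ → Set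
KneserRamsey33≤ r m = ∃[ n ] (n ≤ m × Arrows33 r n)

{-# OPTIONS --safe #-}
module Submission where

-- Upper bounds: in KG(n,r) with n = 4r + 1, fix a vertex v.  In a colouring
-- without monochromatic triangles, three pairwise disjoint neighbours of v are
-- never all joined to v in the same colour.  For r = 2, 3 this forces the
-- edges vw to have, up to the choice of a set A of 3a - 1 points outside v
-- with 1 ≤ a ≤ r, the colour "red iff w has at least a points in A".  Each
-- such pattern is contradictory: with it, some edge implies its own opposite
-- colour through a chain of triangles, whichever colour it has.  The case
-- analysis is a certificate, checked by evaluation.  It starts from the
-- assumption that two particular neighbours of v, sharing r - 1 points, are
-- joined to v in different colours.  As the certificate applies to every
-- relabelling of the points, if it can never be started then all r-sets of
-- consecutive points have the same colour at v, among them three disjoint ones.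
--
-- Lower bound: an explicit colouring of KG(8,2).

open import Defs
open import Data.Bool using (Bool; true; false; not; _∧_; _∨_; _xor_; if_then_else_; T)
open import Data.Bool.Properties using (T-∧; T-≡; ¬-not; not-¬; not-involutive; ∨-comm; ∧-comm)
  renaming (_≟_ to _≟ᵇ_)
open import Data.Empty using (⊥-elim)
open import Data.Fin using (Fin; zero; suc; toℕ)
open import Data.Fin.Properties using (toℕ-fromℕ<) renaming (_≟_ to _≟ᶠ_; all? to allᶠ?)
open import Data.Fin.Subset using (Subset; inside; outside; ∣_∣; _∈_; _∉_; _∩_; ∁) renaming (⊥ to ∅)
open import Data.Fin.Subset.Properties using (_∈?_; anySubset?; ∉⊥; ∣⊥∣≡0)
open import Data.List using (List; []; _∷_; _++_; map; foldr; foldl; length; _∷ʳ_)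
open import Data.List.Properties using (length-map; length-++; map-++)
open import Data.List.Membership.Propositional using () renaming (_∈_ to _∈ₗ_)
open import Data.List.Relation.Unary.All using (All; []; _∷_; lookup)
open import Data.List.Relation.Unary.All.Properties using ()
  renaming (++⁻ˡ to All-++⁻ˡ; ++⁻ʳ to All-++⁻ʳ)
open import Data.List.Relation.Unary.AllPairs using (AllPairs; []; _∷_)
import Data.List.Relation.Unary.AllPairs as AllPairs
open import Data.List.Relation.Unary.AllPairs.Properties using (map⁺; map⁻)
open import Data.List.Relation.Unary.Any using (here; there)
open import Data.List.Relation.Unary.Unique.Propositional using (Unique)
open import Data.Maybe using (Maybe; just; nothing; maybe)
open import Data.Nat using (ℕ; zero; suc; _≤′_; ≤′-refl; ≤′-step; _+_; _*_; _^_; _<ᵇ_; _≡ᵇ_;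
  _/_; _%_; NonZero; s≤s⁻¹)
open import Data.Nat.DivMod using (_mod_; m%n<n)
open import Data.Nat.Properties
  using (_≟_; ≡-irrelevant; ≡ᵇ⇒≡; +-comm; m^n≢0; ≤-refl; ≤⇒≤′)
open import Data.List.Relation.Unary.Unique.DecPropositional _≟_ using (unique?)
open import Data.Product using (Σ; _×_; _,_; proj₁; proj₂)
open import Data.Vec using ([]; _∷_; _[_]≔_)
import Data.Vec as Vec
open import Function using (_∘_; id; Equivalence)
open Equivalence using (to; from)
open import Function.Definitions using (Injective)
open import Relation.Binary.PropositionalEquality
  using (_≡_; _≢_; refl; sym; trans; cong; cong₂; subst; module ≡-Reasoning)
open import Relation.Nullary using (¬_; Dec; yes; no; contradiction)
open import Relation.Nullary.Decidable
  using (⌊_⌋; toWitness; from-yes; from-no; map′; _×-dec_; _→-dec_; ¬?)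

private variable
  n r : ℕ

-- Colourings without monochromatic triangles, and the finite search for such triangles.

MonoFree : EdgeColouring n r → Set
MonoFree c = ∀ b → ¬ MonoTriangle c b

complement : EdgeColouring n r → EdgeColouring n r
complement c .colour u v    = not (colour c u v)
complement c .symmetric u v = cong not (symmetric c u v)

complement-monoFree : {c : EdgeColouring n r} → MonoFree c → MonoFree (complement c)
complement-monoFree {c = c} free b (x , y , z , adj , xy , yz , xz) =
  free (not b) (x , y , z , adj , flip xy , flip yz , flip xz)
  where
    flip : ∀ {k} → not k ≡ b → k ≡ not b
    flip {k} p = trans (sym (not-involutive k)) (cong not p)

-- The size proof inside a vertex is unique, so testing `P` with the one found by `≟` settles it for
-- every vertex on the same subset.
anyVertex? : {P : KVertex n r → Set} → (∀ u → Dec (P u)) → Dec (Σ (KVertex n r) P)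
anyVertex? {r = r} {P} P? =
  map′ (λ (s , p , q) → (s , p) , q) (λ ((s , p) , q) → s , p , q) (anySubset? sized?)
  where
    sized? : ∀ s → Dec (Σ (∣ s ∣ ≡ r) λ p → P (s , p))
    sized? s with ∣ s ∣ ≟ r
    ... | no ∣s∣≢r = no (∣s∣≢r ∘ proj₁)
    ... | yes p =
      map′ (p ,_) (λ (p′ , q) → subst (λ p → P (s , p)) (≡-irrelevant p′ p) q) (P? (s , p))

KAdj? : (u v : KVertex n r) → Dec (KAdj u v)
KAdj? (s , _) (t , _) = allᶠ? λ i → (i ∈? s) →-dec ¬? (i ∈? t)

monoTriangle? : (c : EdgeColouring n r) (b : Bool) → Dec (MonoTriangle c b)
monoTriangle? c b =
  -- The edge `x y` is tested before `z` is chosen, so a pair that fails cuts off the search over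
  -- `z`.
  map′ (λ (x , y , (xy , cxy) , z , (yz , xz) , cyz , cxz) →
         x , y , z , (xy , yz , xz) , cxy , cyz , cxz)
       (λ (x , y , z , (xy , yz , xz) , cxy , cyz , cxz) →
         x , y , (xy , cxy) , z , (yz , xz) , cyz , cxz)
       (anyVertex? λ x → anyVertex? λ y →
         (KAdj? x y ×-dec colour c x y ≟ᵇ b) ×-dec
         anyVertex? λ z → (KAdj? y z ×-dec KAdj? x z) ×-dec
           (colour c y z ≟ᵇ b ×-dec colour c x z ≟ᵇ b))

-- The search is finite, so refuting the absence of a monochromatic triangle constructively produces
-- one.
arrows : (∀ c → ¬ MonoFree {n} {r} c) → Arrows33 r n
arrows not-free c with monoTriangle? c true | monoTriangle? c false
... | yes t | _      = true , t
... | no _  | yes t  = false , t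
... | no ¬t | no ¬t′ = ⊥-elim (not-free c λ { true → ¬t ; false → ¬t′ })

-- Vertices given by lists of points.

AllPairs-++⁻ : ∀ {A : Set} {R : A → A → Set} xs {ys} → AllPairs R (xs ++ ys) →
               AllPairs R xs × AllPairs R ys × All (λ x → All (R x) ys) xs
AllPairs-++⁻ []       ys!         = [] , ys! , []
AllPairs-++⁻ (x ∷ xs) (x∉ ∷ rest) with AllPairs-++⁻ xs rest
... | xs! , ys! , xs#ys = All-++⁻ˡ xs x∉ ∷ xs! , ys! , All-++⁻ʳ xs x∉ ∷ xs#ys

subset : List (Fin n) → Subset n
subset = foldr (λ i s → s [ i ]≔ inside) ∅

∈-insert⁻ : ∀ (s : Subset n) i {j} → j ∈ s [ i ]≔ inside → j ≢ i → j ∈ s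
∈-insert⁻ (_ ∷ s) zero    Vec.here      j≢i = contradiction refl j≢i
∈-insert⁻ (_ ∷ s) zero    (Vec.there p) j≢i = Vec.there p
∈-insert⁻ (_ ∷ s) (suc i) Vec.here      j≢i = Vec.here
∈-insert⁻ (_ ∷ s) (suc i) (Vec.there p) j≢i = Vec.there (∈-insert⁻ s i p (j≢i ∘ cong suc))

∈-subset⁻ : ∀ (xs : List (Fin n)) {j} → j ∈ subset xs → j ∈ₗ xs
∈-subset⁻ []       p = contradiction p ∉⊥
∈-subset⁻ (x ∷ xs) {j} p with j ≟ᶠ x
... | yes j≡x = here j≡x
... | no  j≢x = there (∈-subset⁻ xs (∈-insert⁻ (subset xs) x p j≢x))

∣insert∣ : ∀ (s : Subset n) i → i ∉ s → ∣ s [ i ]≔ inside ∣ ≡ suc ∣ s ∣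
∣insert∣ (outside ∷ s) zero    i∉s = refl
∣insert∣ (inside  ∷ s) zero    i∉s = contradiction Vec.here i∉s
∣insert∣ (outside ∷ s) (suc i) i∉s = ∣insert∣ s i (i∉s ∘ Vec.there)
∣insert∣ (inside  ∷ s) (suc i) i∉s = cong suc (∣insert∣ s i (i∉s ∘ Vec.there))

∣subset∣ : ∀ {xs : List (Fin n)} → Unique xs → ∣ subset xs ∣ ≡ length xs
∣subset∣ {n = n} []  = ∣⊥∣≡0 n
∣subset∣ {xs = x ∷ xs} (x∉xs ∷ xs!) =
  trans (∣insert∣ (subset xs) x (λ p → lookup x∉xs (∈-subset⁻ xs p) refl)) (cong suc (∣subset∣ xs!))

-- The default only serves lists without exactly r distinct points.
vertex : KVertex n r → List (Fin n) → KVertex n r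
vertex {r = r} default xs with ∣ subset xs ∣ ≟ r
... | yes p = subset xs , p
... | no  _ = default

proj₁-vertex : (default : KVertex n r) {xs : List (Fin n)} → Unique xs → length xs ≡ r →
               proj₁ (vertex default xs) ≡ subset xs
proj₁-vertex {r = r} default {xs} xs! len with ∣ subset xs ∣ ≟ r
... | yes _ = refl
... | no  ∣xs∣≢r = contradiction (trans (∣subset∣ xs!) len) ∣xs∣≢r

-- Distinctness of the concatenation does two things: each list has `r` distinct points, so that
-- neither vertex is the default, and the lists share no point.
vertex-adj : (default : KVertex n r) (xs ys : List (Fin n)) → length xs ≡ r → length ys ≡ r →
             Unique (xs ++ ys) → KAdj (vertex default xs) (vertex default ys)
vertex-adj default xs ys lx ly xs++ys! i i∈xs i∈ys with AllPairs-++⁻ xs xs++ys!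
... | xs! , ys! , xs#ys =
  lookup (lookup xs#ys (∈-subset⁻ xs (subst (i ∈_) (proj₁-vertex default xs! lx) i∈xs)))
         (∈-subset⁻ ys (subst (i ∈_) (proj₁-vertex default ys! ly) i∈ys)) refl

-- Codes of vertices, and certificates.

-- Most significant digit first. The length is fixed so that the leading zero of a code such as
-- `0x012` counts as the point 0.
digits : ℕ → ℕ → List ℕ
digits zero    c = []
digits (suc k) c = digits k (c / 16) ∷ʳ c % 16

length-digits : ∀ k c → length (digits k c) ≡ k
length-digits zero    c = refl
length-digits (suc k) c = begin
  length (digits k (c / 16) ∷ʳ c % 16)  ≡⟨ length-++ (digits k (c / 16)) ⟩
  length (digits k (c / 16)) + 1        ≡⟨ cong (_+ 1) (length-digits k (c / 16)) ⟩
  k + 1                                 ≡⟨ +-comm k 1 ⟩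
  suc k                                 ∎
  where open ≡-Reasoning

-- A refutation of the assumption that a colouring of KG(n,r) has no
-- monochromatic triangle, given some coloured edges.  A vertex is coded by r
-- hexadecimal digits, its points; a tuple of vertices by concatenation.
--   abc △ R   ac and bc have the same colour, so ab has the other one;
--   abc ◇ R   with v the apex, vb and vc have the same colour, so va has the
--             other one (as v, a, b, c are pairwise adjacent);
--   split ab  considers both colours of ab, red first;
--   ∎         the last edge obtained already had the opposite colour.
data Refutation : Set where
  _△_   : ℕ → Refutation → Refutation
  _◇_   : ℕ → Refutation → Refutation
  split : ℕ → Refutation → Refutation → Refutation
  ∎     : Refutation

infixr 5 _△_ _◇_

-- Swaps the colours.
mirror : Refutation → Refutation
mirror (t △ R)       = t △ mirror R
mirror (t ◇ R)       = t ◇ mirror R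
mirror (split e R S) = split e (mirror S) (mirror R)
mirror ∎             = ∎

insert : ℕ → List ℕ → List ℕ
insert x []       = x ∷ []
insert x (y ∷ ys) = if x <ᵇ y then x ∷ y ∷ ys else y ∷ insert x ys

nth : List ℕ → ℕ → ℕ
nth []       _       = 0
nth (x ∷ xs) zero    = x
nth (x ∷ xs) (suc i) = nth xs i

module Codes (r : ℕ) where
  instance
    16^r≢0 : NonZero (16 ^ r)
    16^r≢0 = m^n≢0 16 r

  Edge : Set
  Edge = ℕ × ℕ

  pair : ℕ → ℕ × ℕ
  pair c = c / 16 ^ r , c % 16 ^ r

  triple : ℕ → ℕ × ℕ × ℕ
  triple c = proj₁ (pair (c / 16 ^ r)) , proj₂ (pair (c / 16 ^ r)) , c % 16 ^ r

  -- Codes are compared as numbers, so the digits of each vertex are sorted.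
  recode : ℕ → List ℕ → ℕ → ℕ
  recode zero    σ c = 0
  recode (suc k) σ c = recode k σ (c / 16 ^ r) * 16 ^ r
    + foldl (λ m d → m * 16 + d) 0 (foldr insert [] (map (nth σ) (digits r (c % 16 ^ r))))

  -- `σ` lists the images of 0, 1, 2 and so on. No correctness proof is attached: a relabelled
  -- certificate is itself run through `check`, as is a mirrored one.
  relabel : List ℕ → Refutation → Refutation
  relabel σ (t △ R)       = recode 3 σ t △ relabel σ R
  relabel σ (t ◇ R)       = recode 3 σ t ◇ relabel σ R
  relabel σ (split e R S) = split (recode 2 σ e) (relabel σ R) (relabel σ S)
  relabel σ ∎             = ∎

-- The certificate checker.

module Checker (n r : ℕ) .{{_ : NonZero n}} (apex : ℕ) where
  open Codes r public

  Context : Set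
  Context = List (Edge × Bool)

  edge : ℕ → ℕ → Edge
  edge a b = if a <ᵇ b then a , b else (b , a)

  same : Edge → Edge → Bool
  same (a , b) (c , d) = (a ≡ᵇ c) ∧ (b ≡ᵇ d)

  find : Edge → Context → Maybe Bool
  find e []            = nothing
  find e ((f , k) ∷ Γ) = if same e f then just k else find e Γ

  agreed : Maybe Bool → Maybe Bool → Maybe Bool
  agreed (just true)  (just true)  = just true
  agreed (just false) (just false) = just false
  agreed _            _            = nothing

  T-maybe : ∀ {m} {f : Bool → Bool} → T (maybe f false m) → Σ Bool λ k → m ≡ just k × T (f k)
  T-maybe {just k} ok = k , refl , ok

  agreed-just : ∀ {m m′ k} → agreed m m′ ≡ just k → m ≡ just k × m′ ≡ just k
  agreed-just {just true}  {just true}  refl = refl , refl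
  agreed-just {just false} {just false} refl = refl , refl

  -- Reduced modulo `n` in step with `labels`, so that distinctness is tested on the points that a
  -- code really denotes.
  points : ℕ → List ℕ
  points a = map (_% n) (digits r a)

  adjacent? : ∀ a b → Dec (Unique (points a ++ points b))
  adjacent? a b = unique? (points a ++ points b)

  triangle : ℕ → ℕ → ℕ → Bool
  triangle a b c = ⌊ adjacent? a b ⌋ ∧ ⌊ adjacent? b c ⌋ ∧ ⌊ adjacent? a c ⌋

  closed : Context → Bool
  closed []            = false
  closed ((e , k) ∷ Γ) = maybe (k xor_) false (find e Γ)

  check : Context → Refutation → Bool
  check Γ (t △ R) = let a , b , c = triple t in
    triangle a b c ∧
    maybe (λ k → check ((edge a b , not k) ∷ Γ) R) false
          (agreed (find (edge a c) Γ) (find (edge b c) Γ))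
  check Γ (t ◇ R) = let a , b , c = triple t; v = apex in
    triangle a b c ∧ triangle v a b ∧ triangle v a c ∧ triangle v b c ∧
    maybe (λ k → check ((edge v a , not k) ∷ Γ) R) false
          (agreed (find (edge v b) Γ) (find (edge v c) Γ))
  check Γ (split e R S) = let a , b = pair e in
    check ((edge a b , true) ∷ Γ) R ∧ check ((edge a b , false) ∷ Γ) S
  check Γ ∎ = closed Γ

  -- Soundness of the checker, under any injective relabelling `σ` of the points.

  module Soundness (default : KVertex n r) (c : EdgeColouring n r) (free : MonoFree c)
                   (σ : Fin n → Fin n) (σ-injective : Injective _≡_ _≡_ σ) where

    labels : ℕ → List (Fin n)
    labels a = map (σ ∘ (_mod n)) (digits r a)

    V : ℕ → KVertex n r
    V a = vertex default (labels a)

    χ : ℕ → ℕ → Bool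
    χ a b = colour c (V a) (V b)

    -- The check compares the residues `i % n`. These are the values of `i mod n` under `toℕ`, and
    -- `σ` is injective, so distinct residues give distinct labels.
    V-adj : ∀ a b → T ⌊ adjacent? a b ⌋ → KAdj (V a) (V b)
    V-adj a b ok = vertex-adj default (labels a) (labels b) (length-labels a) (length-labels b)
      (subst Unique (map-++ _ (digits r a) (digits r b)) (map⁺ (AllPairs.map distinct
        (map⁻ (subst Unique (sym (map-++ (_% n) (digits r a) (digits r b)))
          (toWitness ok))))))
      where
        length-labels : ∀ a → length (labels a) ≡ r
        length-labels a = trans (length-map _ (digits r a)) (length-digits r a)

        distinct : ∀ {i j} → i % n ≢ j % n → σ (i mod n) ≢ σ (j mod n)
        distinct {i} {j} i≢j eq = i≢j (trans (sym (toℕ-fromℕ< (m%n<n i n)))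
          (trans (cong toℕ (σ-injective eq)) (toℕ-fromℕ< (m%n<n j n))))

    not-mono : ∀ a b d {k} → T (triangle a b d) → χ a b ≡ k → χ b d ≡ k → χ a d ≢ k
    not-mono a b d {k} ok ab bd ad =
      let ab-adj , rest = to T-∧ ok
          bd-adj , ad-adj = to T-∧ rest
      in free k (V a , V b , V d ,
                 (V-adj a b ab-adj , V-adj b d bd-adj , V-adj a d ad-adj) , ab , bd , ad)

    triangle-sound : ∀ a b d {k} → T (triangle a b d) →
                     χ a d ≡ k → χ b d ≡ k → χ a b ≡ not k
    triangle-sound a b d abd ad bd = ¬-not λ ab → not-mono a b d abd ab bd ad

    -- If `v a` also had colour `k`, the triangles through `v` would force `a b`, `b d` and `a d` to
    -- have the opposite colour, making `a b d` monochromatic.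
    clique-sound : ∀ v a b d {k} → T (triangle a b d) →
                   T (triangle v a b) → T (triangle v a d) → T (triangle v b d) →
                   χ v b ≡ k → χ v d ≡ k → χ v a ≡ not k
    clique-sound v a b d {k} abd vab vad vbd vb vd = ¬-not λ va →
      not-mono a b d abd (opposite a b vab va vb) (opposite b d vbd vb vd) (opposite a d vad va vd)
      where
        opposite : ∀ x y → T (triangle v x y) → χ v x ≡ k → χ v y ≡ k → χ x y ≡ not k
        opposite x y vxy vx vy = ¬-not λ xy → not-mono v x y vxy vx xy vy

    ⟦_⟧ : Edge → Bool
    ⟦ a , b ⟧ = χ a b

    ⟦edge⟧ : ∀ a b → ⟦ edge a b ⟧ ≡ χ a b
    ⟦edge⟧ a b with a <ᵇ b
    ... | true  = refl
    ... | false = symmetric c (V b) (V a)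

    Holds : Context → Set
    Holds = All (λ (e , k) → ⟦ e ⟧ ≡ k)

    find-sound : ∀ {e Γ k} → Holds Γ → find e Γ ≡ just k → ⟦ e ⟧ ≡ k
    find-sound {a , b} {((a′ , b′) , l) ∷ Γ} (h ∷ hs) eq with same (a , b) (a′ , b′) in eq′
    ... | false = find-sound hs eq
    ... | true with to T-∧ (from T-≡ eq′) | eq
    ...   | a≡a′ , b≡b′ | refl = trans (cong₂ χ (≡ᵇ⇒≡ a a′ a≡a′) (≡ᵇ⇒≡ b b′ b≡b′)) h

    edge-sound : ∀ a b {Γ k} → Holds Γ → find (edge a b) Γ ≡ just k → χ a b ≡ k
    edge-sound a b hs eq = trans (sym (⟦edge⟧ a b)) (find-sound hs eq)

    -- Induction on the certificate: every edge added to the context carries its true colour, a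
    -- split follows the branch of the actual colour, and `∎` would give one edge two colours.
    refute : ∀ Γ R → Holds Γ → ¬ T (check Γ R)
    refute Γ (t △ R) hs ok =
      let a , b , d = triple t
          abd , ok₁ = to T-∧ ok
          k , agree , ok₂ = T-maybe ok₁
          ad , bd = agreed-just agree
          ab = triangle-sound a b d abd (edge-sound a d hs ad) (edge-sound b d hs bd)
      in refute _ R (trans (⟦edge⟧ a b) ab ∷ hs) ok₂
    refute Γ (t ◇ R) hs ok =
      let a , b , d = triple t
          v = apex
          abd , ok₁ = to T-∧ ok
          vab , ok₂ = to T-∧ ok₁
          vad , ok₃ = to T-∧ ok₂
          vbd , ok₄ = to T-∧ ok₃
          k , agree , ok₅ = T-maybe ok₄
          vb , vd = agreed-just agree
          va = clique-sound v a b d abd vab vad vbd (edge-sound v b hs vb) (edge-sound v d hs vd)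
      in refute _ R (trans (⟦edge⟧ v a) va ∷ hs) ok₅
    refute Γ (split e R S) hs ok with to T-∧ ok | ⟦ pair e ⟧ in eq
    ... | okR , okS | true  = refute _ R (trans (⟦edge⟧ _ _) eq ∷ hs) okR
    ... | okR , okS | false = refute _ S (trans (⟦edge⟧ _ _) eq ∷ hs) okS
    refute ((e , k) ∷ Γ) ∎ (h ∷ hs) ok with T-maybe {find e Γ} ok
    ... | l , eq , k≢l with trans (sym h) (find-sound hs eq)
    -- The two colours now coincide, but `k xor k` reduces to `false` only once `k` is a
    -- constructor.
    refute ((e , true)  ∷ Γ) ∎ (h ∷ hs) ok | _ , _ , () | refl
    refute ((e , false) ∷ Γ) ∎ (h ∷ hs) ok | _ , _ , () | refl

  -- If e is red and f is blue, R refutes the colouring; if e is blue and f is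
  -- red, it refutes the complementary one.
  equal-colours : ∀ e f R → T (check ((edge apex e , true) ∷ (edge apex f , false) ∷ []) R) →
                  ∀ default c free σ (σ-injective : Injective _≡_ _≡_ σ) →
                  let open Soundness default c free σ σ-injective in χ apex e ≡ χ apex f
  equal-colours e f R checked default c free σ σ-injective
    with colour c (V apex) (V e) in eq-e | colour c (V apex) (V f) in eq-f
    where open Soundness default c free σ σ-injective
  ... | true  | true  = refl
  ... | false | false = refl
  ... | true  | false = ⊥-elim (refute _ R
    (trans (⟦edge⟧ apex e) eq-e ∷ trans (⟦edge⟧ apex f) eq-f ∷ []) checked)
    where open Soundness default c free σ σ-injective
  ... | false | true  = ⊥-elim (refute _ R
    (trans (⟦edge⟧ apex e) (cong not eq-e) ∷ trans (⟦edge⟧ apex f) (cong not eq-f) ∷ []) checked)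
    where open Soundness default (complement c) (complement-monoFree {c = c} free) σ σ-injective

-- Iterates of a permutation of the points.

power : (Fin n → Fin n) → ℕ → Fin n → Fin n
power σ zero    = id
power σ (suc k) = σ ∘ power σ k

power-injective : {σ : Fin n → Fin n} → Injective _≡_ _≡_ σ → ∀ k → Injective _≡_ _≡_ (power σ k)
power-injective σ-injective zero    = id
power-injective σ-injective (suc k) = power-injective σ-injective k ∘ σ-injective

-- Every colouring of KG(9,2) has a monochromatic triangle.

module KG₉₂ where
  open Checker 9 2 0x78

  -- For the edges at 78 red iff they lead to a vertex meeting {0,1}.
  coverPattern : Refutation
  coverPattern =
    0x031278 △ 0x041278 △ 0x051278 △ 0x061278 △ 0x021378 △ 0x061378 △ 0x021478 △ 0x051478 △
    0x021578 △ 0x041578 △ 0x021678 △ 0x031678 △ 0x253478 △ 0x263478 △ 0x243578 △ 0x263578 △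
    0x234678 △ 0x254678 △ 0x354678 △ 0x235678 △ 0x245678 △ 0x345678 △
    -- `12` and `35` have different colours at `78`, so the triangle with `78` leaves the colour of
    -- this edge open.
    split 0x1235
      (0x124635 △ 0x034612 △ 0x054612 △ 0x032546 △ 0x052346 △ 0x162503 △ 0x142305 △ 0x163425 △
       0x145623 △ 0x023416 △ 0x025614 △ 0x560234 △ ∎)
      (0x043512 △ 0x063512 △ 0x042635 △ 0x062435 △ 0x152604 △ 0x132406 △ 0x153426 △ 0x135624 △
       0x023415 △ 0x025613 △ 0x560234 △ ∎)

  cover : ℕ → Refutation
  cover σ = relabel (digits 9 σ) coverPattern

  -- Starts from `01` red and `12` blue at `78`. The `◇` steps propagate colours at `78` only, until
  -- they fit a pattern: `cover` is a = 1, and `mirror (cover σ)` is a = 2, since lying inside five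
  -- of the seven points means missing the other two. Each `σ` fixes 7 and 8.
  refutation : Refutation
  refutation =
    split 0x4678
    (0x234601 ◇ 0x254601 ◇ 0x354601 ◇ 0x043512 ◇ 0x063512 ◇
     split 0x3678
     (0x243601 ◇ 0x453601 ◇ 0x153604 ◇ 0x162435 ◇ 0x034512 ◇
      split 0x3478
      (0x263401 ◇ 0x563401 ◇ 0x023416 ◇ 0x053416 ◇ 0x142635 ◇ mirror (cover 0x524160378))
      (0x023415 ◇ 0x053412 ◇ 0x563412 ◇ 0x263415 ◇ 0x140236 ◇ cover 0x604152378))
     (0x053612 ◇ 0x453612 ◇ 0x143625 ◇ 0x130546 ◇ 0x264501 ◇
      split 0x5678
      (0x245601 ◇ 0x345601 ◇ 0x025614 ◇ 0x035614 ◇ 0x152436 ◇ mirror (cover 0x235104678))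
      (0x025613 ◇ 0x035612 ◇ 0x345612 ◇ 0x245613 ◇ 0x160245 ◇ cover 0x406215378)))
    (0x034612 ◇ 0x054612 ◇ 0x354612 ◇ 0x243501 ◇ 0x263501 ◇
     split 0x4578
     (0x234501 ◇ 0x364501 ◇ 0x164503 ◇ 0x152346 ◇ 0x043612 ◇
      split 0x3478
      (0x253401 ◇ 0x563401 ◇ 0x023415 ◇ 0x063415 ◇ 0x142536 ◇ mirror (cover 0x625431078))
      (0x023416 ◇ 0x063412 ◇ 0x563412 ◇ 0x253416 ◇ 0x130245 ◇ cover 0x503614278))
     (0x064512 ◇ 0x364512 ◇ 0x134526 ◇ 0x140635 ◇ 0x253601 ◇
      split 0x1578
      (0x021536 ◇ 0x041536 ◇ 0x231506 ◇ 0x341506 ◇ 0x560214 ◇ 0x160245 ◇ mirror (cover 0x426031578))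
      (0x021546 ◇ 0x041526 ◇ 0x231546 ◇ 0x341526 ◇ 0x560213 ◇ 0x160235 ◇ cover 0x306541278)))

  default : KVertex 9 2
  default = Vec.replicate 2 inside Vec.++ Vec.replicate 7 outside , refl

  rotation : Fin 9 → Fin 9
  -- A 7-cycle on the points outside the apex, fixing 7 and 8.
  rotation = Vec.lookup (Vec.map (_mod 9) (1 ∷ 2 ∷ 3 ∷ 4 ∷ 5 ∷ 6 ∷ 0 ∷ 7 ∷ 8 ∷ []))

  rotation-injective : Injective _≡_ _≡_ rotation
  rotation-injective {i} {j} =
    from-yes (allᶠ? λ i → allᶠ? λ j → (rotation i ≟ᶠ rotation j) →-dec (i ≟ᶠ j)) i j

  not-monoFree : (c : EdgeColouring 9 2) → ¬ MonoFree c
  -- `01`, `23` and `45` are disjoint and have one colour at `78`, so `clique-sound` makes the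
  -- colour of the edge from `78` to `01` its own opposite.
  not-monoFree c free = not-¬ {χ 0x78 0x01} refl
    (clique-sound 0x78 0x01 0x23 0x45 _ _ _ _ (sym first) (sym (trans first second)))
    where
      open Soundness default c free id id

      -- After `k` rotations the codes `01` and `12` denote {k, k+1} and {k+1, k+2}, with indices
      -- modulo 7. The vertices evaluate to the same terms as those of the unrotated codes, so
      -- successive steps compose.
      step : ∀ k → let module S = Soundness default c free
                         (power rotation k) (power-injective rotation-injective k) in
             S.χ 0x78 0x01 ≡ S.χ 0x78 0x12
      step k =
        equal-colours 0x01 0x12 refutation _ default c free
          (power rotation k) (power-injective rotation-injective k)

      first : χ 0x78 0x01 ≡ χ 0x78 0x23
      first = trans (step 0) (step 1)

      second : χ 0x78 0x23 ≡ χ 0x78 0x45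
      second = trans (step 2) (step 3)

-- Every colouring of KG(13,3) has a monochromatic triangle.

module KG₁₃₃ where
  open Checker 13 3 0xabc

  -- For the edges at abc red iff they lead to a vertex meeting {0,1}.
  coverPattern : Refutation
  coverPattern =
    0x048123abc △ 0x069123abc △ 0x078123abc △ 0x079123abc △ 0x034125abc △ 0x078125abc △
    0x056139abc △ 0x078139abc △ 0x023146abc △ 0x025146abc △ 0x078146abc △ 0x079146abc △
    0x023159abc △ 0x048159abc △ 0x023178abc △ 0x025178abc △ 0x034178abc △ 0x056178abc △
    0x069178abc △ 0x259346abc △ 0x256349abc △ 0x239456abc △ 0x235468abc △ 0x235469abc △
    0x236478abc △ 0x239478abc △ 0x256478abc △ 0x234569abc △ 0x478569abc △ 0x234578abc △
    0x469578abc △ 0x236579abc △ 0x468579abc △ 0x259678abc △ 0x349678abc △ 0x235789abc △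
    0x346789abc △ 0x456789abc △
    split 0x146235
      (0x146789235 △ 0x023789146 △ 0x025789146 △ 0x023456789 △ 0x025346789 △ 0x178456023 △
       0x178346025 △ 0x178239456 △ 0x178259346 △ 0x056239178 △ 0x034259178 △ 0x056478239 △
       0x034678259 △ 0x139478056 △ 0x125678034 △ 0x139256478 △ 0x125349678 △ 0x078256139 △
       0x078349125 △ 0x349078256 △ ∎)
      (0x078235146 △ 0x079235146 △ 0x078469235 △ 0x079468235 △ 0x123469078 △ 0x123468079 △
       0x123578469 △ 0x123579468 △ 0x069578123 △ 0x048579123 △ 0x069234578 △ 0x048236579 △
       0x178234069 △ 0x159236048 △ 0x178569234 △ 0x159478236 △ 0x023569178 △ 0x023478159 △
       0x478023569 △ ∎)

  -- For the edges at abc red iff they lead to a vertex with two points in {0,1,2,3,4}.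
  majorityPattern : Refutation
  majorityPattern =
    0x047136abc △ 0x027145abc △ 0x038145abc △ 0x078156abc △ 0x017236abc △ 0x145236abc △
    0x047239abc △ 0x145239abc △ 0x015249abc △ 0x017249abc △ 0x038249abc △ 0x136249abc △
    0x078269abc △ 0x157269abc △ 0x158279abc △ 0x057289abc △ 0x156289abc △ 0x015346abc △
    0x027346abc △ 0x057368abc △ 0x157368abc △ 0x279368abc △ 0x078369abc △ 0x158369abc △
    0x078459abc △ 0x368459abc △
    split 0x078145
      (0x145269078 △ 0x145369078 △ 0x038269145 △ 0x027369145 △ 0x038157269 △ 0x027158369 △
       0x157249038 △ 0x158346027 △ 0x249368157 △ 0x279346158 △ 0x015368249 △ 0x015279346 △
       0x279015368 △ ∎)
      (0x078236145 △ 0x078239145 △ 0x236459078 △ 0x156239078 △ 0x017459236 △ 0x047156239 △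
       0x017368459 △ 0x047289156 △ 0x249368017 △ 0x136289047 △ 0x057249368 △ 0x057136289 △
       0x136057249 △ ∎)

  cover majority : ℕ → Refutation
  cover σ    = relabel (digits 13 σ) coverPattern
  majority σ = relabel (digits 13 σ) majorityPattern

  -- Starts from `012` red and `123` blue at `abc`. The patterns reached are `cover` for a = 1,
  -- `majority` for a = 2 and `mirror (cover σ)` for a = 3. `mirror (majority σ)` is again a = 2: a
  -- triple with at most one point in five of the ten has at least two in the other five.
  refutation : Refutation
  refutation =
    split 0x689abc
    (0x345689012 ◇ 0x347689012 ◇ 0x357689012 ◇ 0x457689012 ◇ 0x068457123 ◇ 0x069457123 ◇
     0x089457123 ◇
     split 0x567abc
     (0x348567012 ◇ 0x349567012 ◇ 0x389567012 ◇ 0x489567012 ◇ 0x124567089 ◇ 0x134567089 ◇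
      0x234567089 ◇ 0x016389457 ◇ 0x026389457 ◇ 0x126389457 ◇ 0x056489123 ◇ 0x057489123 ◇
      0x067489123 ◇
      split 0x189abc
      (0x023189567 ◇ 0x024189567 ◇ 0x034189567 ◇ 0x237189056 ◇ 0x247189056 ◇ 0x236189057 ◇
       0x246189057 ◇ 0x245189067 ◇ 0x156023489 ◇ 0x157023489 ◇ 0x167023489 ◇ 0x015237489 ◇
       0x017236489 ◇ 0x018236457 ◇
       split 0x789abc
       (0x356789012 ◇ 0x135789026 ◇ 0x145789026 ◇ 0x035789126 ◇ 0x178356024 ◇ 0x027356489 ◇
        0x127356489 ◇ 0x678135024 ◇ 0x267135489 ◇ 0x359178026 ◇ 0x459178026 ◇
        split 0x589abc
        (0x367589012 ◇ 0x467589012 ◇ 0x013589267 ◇ 0x014589267 ◇ 0x137589026 ◇ 0x147589026 ◇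
         0x159367024 ◇ 0x028367145 ◇ 0x059367124 ◇ 0x125367489 ◇ 0x259013467 ◇ 0x268013457 ◇
         0x468159027 ◇ 0x038159267 ◇ mirror (cover 0x4376810592abc))
        (0x013589246 ◇ 0x146589023 ◇ 0x147589023 ◇ 0x467589023 ◇ 0x137589024 ◇ 0x036589124 ◇
         0x047589123 ◇ 0x256013789 ◇ 0x025146789 ◇ 0x125467089 ◇
         split 0x039abc
         (0x478039126 ◇ 0x568039127 ◇ 0x268039147 ◇ 0x159478023 ◇ 0x479568023 ◇
          majority 0x1097624538abc)
         (0x568039124 ◇ 0x478039125 ◇ 0x479568012 ◇ mirror (majority 0x3294567018abc))))
       (0x013789245 ◇ 0x145789023 ◇ 0x456789023 ◇ 0x135789024 ◇ 0x025789134 ◇ 0x256789034 ◇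
        0x045789123 ◇ 0x027145689 ◇ 0x037145689 ◇ 0x267145089 ◇ 0x127456089 ◇ 0x137456089 ◇
        0x467135089 ◇ 0x589027134 ◇
        split 0x269abc
        (0x458269013 ◇ 0x578269013 ◇ 0x138269045 ◇ 0x679458023 ◇ 0x139458027 ◇ 0x049578123 ◇
         0x678139025 ◇ mirror (majority 0x7823491650abc))
        (0x178269034 ◇ 0x458269037 ◇ 0x048269137 ◇ 0x459178026 ◇ 0x049178256 ◇ 0x179458026 ◇
         0x368459027 ◇ mirror (majority 0x4927381056abc))))
      (0x023189457 ◇ 0x024189357 ◇ 0x025189347 ◇ 0x046189357 ◇ 0x236189457 ◇ 0x246189357 ◇
       0x148023567 ◇ 0x149023567 ◇ 0x157023689 ◇ 0x138024567 ◇ 0x139024567 ◇ 0x269148357 ◇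
       split 0x579abc
       (0x346579012 ◇ 0x368579012 ◇ 0x468579012 ◇ 0x014579236 ◇ 0x238579016 ◇ 0x248579016 ◇
        0x146579023 ◇ 0x034579126 ◇ 0x038579126 ◇ 0x257346189 ◇ 0x019368457 ◇ 0x049368157 ◇
        0x129368457 ◇ 0x249368157 ◇ 0x239468157 ◇ 0x169238457 ◇ 0x369248157 ◇ 0x578019236 ◇
        split 0x078abc
        (0x125078369 ◇ 0x456078129 ◇ 0x235078169 ◇ 0x789125034 ◇ 0x467125038 ◇
         mirror (majority 0x4513872609abc))
        (0x456078123 ◇ 0x459078123 ◇ 0x356078124 ◇ 0x125078346 ◇ 0x379456012 ◇ 0x678459012 ◇
         0x047356129 ◇ 0x568379014 ◇ mirror (majority 0x7814369502abc)))
       (0x018579234 ◇ 0x038579124 ◇ 0x468579123 ◇ 0x368579124 ◇ 0x459018236 ◇ 0x239018567 ◇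
        0x249018567 ◇ 0x129038567 ◇ 0x678459123 ◇
        split 0x578abc
        (0x346578012 ◇ 0x369578012 ◇ 0x469578012 ◇ 0x013578246 ◇ 0x014578236 ◇ 0x019578236 ◇
         0x169578023 ◇ 0x136578024 ◇ 0x289346157 ◇ 0x257346189 ◇ 0x248369157 ◇
         split 0x458abc
         (0x367458012 ◇ 0x017458236 ◇ 0x015367249 ◇ 0x245367019 ◇ 0x789015236 ◇
          mirror (majority 0x9417325680abc))
         (0x279458013 ◇ 0x679458013 ◇ 0x237458019 ◇ 0x015279368 ◇ 0x235679018 ◇ 0x478015239 ◇
          majority 0x7208639541abc))
        (0x013578249 ◇ 0x019578234 ◇ 0x034578129 ◇ 0x469578123 ◇ 0x346578129 ◇ 0x245013678 ◇
         0x789013246 ◇ 0x257013468 ◇ 0x125034678 ◇ 0x128034567 ◇ 0x079245138 ◇ cover 0x0634281759abc))))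
     (0x048567123 ◇ 0x049567123 ◇ 0x489567123 ◇ 0x356489012 ◇ 0x367489012 ◇
      split 0x126abc
      (0x035126489 ◇ 0x037126489 ◇ 0x359126048 ◇ 0x379126048 ◇ 0x579126048 ◇ 0x378126049 ◇
       0x578126049 ◇ 0x057126489 ◇ 0x046579123 ◇ 0x468579123 ◇ 0x469578123 ◇
       split 0x245abc
       (0x013245689 ◇ 0x017245689 ◇ 0x179245068 ◇ 0x136245089 ◇ 0x167245089 ◇ 0x249013567 ◇
        0x269013457 ◇
        split 0x459abc
        (0x368459012 ◇ 0x678459012 ◇ 0x038459126 ◇ 0x127459068 ◇ 0x078459126 ◇ 0x014368579 ◇
         0x259368017 ◇ 0x019368457 ◇ 0x025368179 ◇ 0x045368179 ◇ 0x124368057 ◇ 0x129368057 ◇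
         0x146038579 ◇ 0x456038179 ◇ 0x569127038 ◇ 0x235014689 ◇ 0x257014689 ◇ 0x147259068 ◇
         0x389045126 ◇ 0x016389257 ◇
         split 0x018abc
         (0x234018569 ◇ 0x236018459 ◇ 0x239018456 ◇ 0x346018259 ◇ 0x279018456 ◇ 0x015234678 ◇
          0x568234017 ◇ 0x058234167 ◇ 0x145236078 ◇ mirror (cover 0x3780164925abc))
         (0x234018567 ◇ 0x467018235 ◇ 0x679018235 ◇ 0x239018457 ◇ 0x349018257 ◇ 0x369018257 ◇
          0x015234689 ◇ 0x258467019 ◇ 0x125467089 ◇ majority 0x0269453187abc))
        (0x678459013 ◇ 0x368459017 ◇ 0x018459367 ◇ 0x027459136 ◇ 0x128459037 ◇ 0x078459123 ◇
         0x349678012 ◇ 0x019678245 ◇ 0x125678049 ◇ 0x127368049 ◇ 0x079368245 ◇ 0x369018245 ◇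
         0x346019578 ◇ mirror (majority 0x7193526084abc)))
       (0x016245378 ◇ 0x189245037 ◇ 0x257016489 ◇
        split 0x289abc
        (0x157289046 ◇
         split 0x045abc
         (0x789045126 ◇ 0x136045289 ◇ 0x136245789 ◇ ∎)
         (0x678045123 ◇ 0x679045123 ◇ 0x789045123 ◇ 0x128045367 ◇ 0x129045367 ◇ 0x349678012 ◇
          0x459678012 ◇ 0x125678049 ◇ 0x348679012 ◇ 0x458679012 ◇ 0x346789012 ◇ 0x456789012 ◇
          0x034789126 ◇ 0x026349157 ◇ 0x067459123 ◇ 0x078459123 ◇ 0x079348125 ◇ 0x145026789 ◇
          split 0x127abc
          (0x036127489 ◇ 0x389127046 ◇ 0x056127489 ◇ 0x478036125 ◇ 0x479036125 ◇ 0x279036145 ◇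
           0x148036257 ◇ 0x249036157 ◇ 0x178036245 ◇ 0x017389245 ◇ 0x239478016 ◇ 0x259478016 ◇
           0x138479026 ◇ mirror (cover 0x3529418067abc))
          (0x568127034 ◇ 0x589127034 ◇ 0x036127458 ◇ 0x039127456 ◇ 0x124568079 ◇ 0x467589012 ◇
           split 0x158abc
           (0x023158469 ◇ 0x249158036 ◇ 0x013249567 ◇ mirror (majority 0x4532781690abc))
           (0x023158467 ◇ 0x146023589 ◇ 0x179023468 ◇ 0x258146037 ◇ mirror (majority 0x7351402698abc)))))
        (0x013289457 ◇ 0x015289347 ◇ 0x034289567 ◇ 0x147289035 ◇ 0x467289035 ◇ 0x036289457 ◇
         0x145289037 ◇ 0x045289367 ◇ 0x047289356 ◇ 0x247013689 ◇ 0x256013489 ◇ 0x267013489 ◇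
         0x236015489 ◇ 0x125034689 ◇ 0x589034126 ◇ 0x789034126 ◇ 0x023147689 ◇ 0x389467012 ◇
         0x027145689 ◇ 0x024589367 ◇ 0x026589347 ◇ 0x246589037 ◇
         split 0x158abc
         (0x369158024 ◇ 0x679158024 ◇ 0x269158034 ◇ 0x039158246 ◇ 0x458369027 ◇ 0x038679125 ◇
          majority 0x4608129753abc)
         (0x479158023 ◇ 0x679158023 ◇ 0x269158037 ◇ 0x368479012 ◇ 0x138479026 ◇ 0x458679012 ◇
          0x459368027 ◇ mirror (majority 0x8523740916abc)))))
      (0x038126457 ◇ 0x039126457 ◇ 0x059126347 ◇ 0x789126345 ◇ 0x589126347 ◇ 0x389126457 ◇
       0x346789012 ◇ 0x456789012 ◇ 0x467589012 ◇
       split 0x168abc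
       (0x247168039 ◇
        split 0x157abc
        (0x023157489 ◇ 0x024157389 ◇ 0x026157389 ◇ 0x034157689 ◇ 0x036157489 ◇ 0x249157038 ◇
         0x269157038 ◇ 0x469157038 ◇ 0x468157039 ◇ 0x368157049 ◇ 0x148023567 ◇ 0x149023567 ◇
         0x578034126 ◇ 0x579034126 ◇ 0x128034567 ◇ 0x129034567 ◇ 0x013249567 ◇ 0x014269357 ◇
         0x057469123 ◇ 0x029468357 ◇ 0x124578039 ◇ 0x134578069 ◇
         split 0x459abc
         (0x678459012 ◇ 0x278459013 ◇ 0x037459128 ◇ 0x035678124 ◇ mirror (majority 0x2437695180abc))
         (0x167459023 ◇ 0x678459023 ◇ 0x137459026 ◇ 0x025167389 ◇ 0x568137029 ◇
          mirror (majority 0x2456318097abc)))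
        (0x029157346 ◇ 0x289157346 ◇
         split 0x468abc
         (0x359468012 ◇ 0x379468012 ◇ 0x579468012 ◇ 0x135468029 ◇ 0x125468039 ◇ 0x127468039 ◇
          0x047359126 ◇ 0x478359126 ◇ 0x128359467 ◇ 0x045379126 ◇ 0x458379126 ◇ 0x348579126 ◇
          0x136047289 ◇ 0x239047168 ◇ 0x259047168 ◇ 0x369478012 ◇ 0x569478012 ◇ 0x679045128 ◇
          0x279045168 ◇ 0x024136579 ◇ 0x015239467 ◇ 0x158239467 ◇ 0x138259467 ◇ 0x269015348 ◇
          split 0x169abc
          (0x023169458 ◇ 0x358169024 ◇ 0x378169024 ◇ 0x027169348 ◇ 0x469023157 ◇ 0x129358467 ◇
           majority 0x8419076352abc)
          (0x023169457 ◇ 0x035169247 ◇ 0x278169345 ◇ 0x145023689 ◇ 0x469023158 ◇ 0x479023158 ◇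
           0x124035689 ◇ 0x036145279 ◇ 0x368145279 ◇ cover 0x8069734125abc))
         (0x023468157 ◇ 0x579468123 ◇ 0x579023168 ◇ ∎)))
       (0x023168457 ◇ 0x024168357 ◇ 0x239168457 ◇ 0x249168357 ◇ 0x259168347 ◇ 0x279168345 ◇
        0x146023589 ◇ 0x147023589 ◇ 0x157023489 ◇ 0x135024689 ◇
        split 0x578abc
        (0x349578012 ◇ 0x469578012 ◇ 0x013578249 ◇ 0x016578239 ◇ 0x169578023 ◇ 0x036578249 ◇
         0x124578039 ◇ 0x246578039 ◇ 0x236578049 ◇ 0x018349567 ◇ 0x057349126 ◇ 0x128349567 ◇
         0x257349168 ◇ 0x238469157 ◇ 0x269013457 ◇ 0x129036457 ◇ 0x189036457 ◇ 0x579124036 ◇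
         0x148057239 ◇ 0x368057249 ◇ 0x034257689 ◇
         split 0x158abc
         (0x479158023 ◇ 0x037158249 ◇ 0x256479013 ◇ 0x459037126 ◇ 0x017256389 ◇
          mirror (majority 0x1374629085abc))
         (0x267158034 ◇ 0x247158036 ◇ 0x037158246 ◇ 0x035267189 ◇ 0x569247018 ◇
          majority 0x2907865143abc))
        (0x034578126 ◇ 0x046578123 ◇ 0x349578126 ◇ 0x129578346 ◇ 0x125034689 ◇ 0x127034589 ◇
         0x256034789 ◇ 0x678034259 ◇ 0x568034279 ◇ 0x138046259 ◇ 0x237046589 ◇ 0x378046259 ◇
         0x358046279 ◇ 0x189256347 ◇ 0x045678123 ◇ 0x459678123 ◇ 0x479568123 ◇ 0x368045129 ◇
         split 0x128abc
         (0x569128034 ◇ 0x579128034 ◇ 0x036128459 ◇ 0x056128349 ◇ 0x067128349 ◇ 0x124569378 ◇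
          0x348569127 ◇ 0x238569147 ◇ majority 0x9028463571abc)
         (0x035128467 ◇ 0x037128456 ◇ 0x057128346 ◇ 0x569128347 ◇ 0x359128467 ◇ 0x124035689 ◇
          0x468035129 ◇ 0x247035189 ◇ 0x015468237 ◇ cover 0x0986437125abc))))))
    (0x045689123 ◇ 0x047689123 ◇ 0x057689123 ◇ 0x457689123 ◇ 0x368457012 ◇ 0x369457012 ◇
     0x389457012 ◇
     split 0x679abc
     (0x345679012 ◇ 0x358679012 ◇ 0x458679012 ◇ 0x128679045 ◇ 0x138679045 ◇ 0x238679045 ◇
      0x017345689 ◇ 0x027345689 ◇ 0x127345689 ◇ 0x067458123 ◇ 0x069458123 ◇ 0x079458123 ◇
      split 0x124abc
      (0x035124679 ◇ 0x038124679 ◇ 0x058124679 ◇ 0x359124067 ◇ 0x357124069 ◇ 0x378124069 ◇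
       0x578124069 ◇ 0x568124079 ◇ 0x469035128 ◇ 0x479035128 ◇ 0x147035689 ◇ 0x247035689 ◇
       0x046359128 ◇ 0x014357689 ◇ 0x158469027 ◇
       split 0x269abc
       (0x013269457 ◇ 0x137269045 ◇ 0x178269045 ◇ 0x148269057 ◇ 0x245013689 ◇ 0x257013689 ◇
        0x267013458 ◇ 0x025137689 ◇ 0x136245079 ◇
        split 0x569abc
        (0x347569012 ◇ 0x478569012 ◇ 0x237569014 ◇ 0x234569017 ◇ 0x048569127 ◇ 0x015347689 ◇
         0x126347058 ◇ 0x169347058 ◇ 0x349015267 ◇ mirror (cover 0x3850172964abc))
        (0x248569013 ◇ 0x278569013 ◇ 0x478569013 ◇ 0x023569148 ◇ 0x037569128 ◇ 0x015248679 ◇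
         0x169248057 ◇ 0x159248067 ◇ 0x145278069 ◇
         split 0x678abc
         (0x239678014 ◇ 0x149678023 ◇ 0x039678124 ◇ 0x146239058 ◇ majority 0x7046239581abc)
         (0x259678013 ◇ 0x459678013 ◇ 0x239678015 ◇ 0x129678035 ◇ 0x059678123 ◇ 0x036259147 ◇
          0x056239147 ◇ mirror (majority 0x5618307942abc))))
       (0x013269458 ◇ 0x034269158 ◇ 0x148269035 ◇ 0x037269158 ◇ 0x245013679 ◇ 0x248013679 ◇
        0x257013469 ◇ 0x289013457 ◇ 0x125034679 ◇ 0x023148679 ◇ 0x016245378 ◇ 0x179245038 ◇
        split 0x129abc
        (0x567129034 ◇ 0x036129457 ◇ 0x189567023 ◇ 0x489567023 ◇ 0x039567128 ◇ 0x126489037 ◇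
         majority 0x1970483265abc)
        (0x468129035 ◇ 0x678129035 ◇ 0x036129458 ◇ 0x579468012 ◇ 0x789036124 ◇
         majority 0x0167429358abc)))
      (0x035124689 ◇ 0x037124689 ◇ 0x056124389 ◇ 0x058124369 ◇ 0x078124369 ◇ 0x357124689 ◇
       0x578124369 ◇ 0x567124389 ◇ 0x468035127 ◇ 0x469035127 ◇ 0x349056127 ◇ 0x134058679 ◇
       0x234058679 ◇ 0x257469138 ◇ 0x157469238 ◇
       split 0x129abc
       (0x034129567 ◇ 0x467129035 ◇ 0x678129035 ◇ 0x036129457 ◇ 0x456129037 ◇ 0x038129457 ◇
        0x367129045 ◇ 0x378129045 ◇ 0x125034689 ◇ 0x039467128 ◇ 0x089467123 ◇ 0x459678123 ◇
        0x789036124 ◇ 0x379456128 ◇ 0x126039457 ◇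
        split 0x013abc
        (0x245013679 ◇ 0x267013459 ◇ 0x178245036 ◇ 0x145267038 ◇ 0x023178459 ◇
         mirror (majority 0x2483659107abc))
        (0x245013678 ◇ 0x018245379 ◇ 0x169245037 ◇ 0x028169345 ◇ majority 0x0275914836abc))
       (0x036129458 ◇ 0x046129358 ◇ 0x068129345 ◇ 0x467129358 ◇ 0x367129458 ◇ 0x459036127 ◇
        0x589036127 ◇ 0x149036257 ◇ 0x289036157 ◇ 0x359046127 ◇ 0x239046157 ◇ 0x016459238 ◇
        0x167459238 ◇
        split 0x126abc
        (0x034126578 ◇ 0x478126035 ◇ 0x789126035 ◇ 0x038126457 ◇ 0x378126045 ◇ 0x379126045 ◇
         0x089126357 ◇ 0x125034689 ◇ 0x569034128 ◇ 0x356478129 ◇ 0x456789123 ◇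
         split 0x029abc
         (0x135029467 ◇ 0x137029456 ◇ 0x146029357 ◇ 0x246135089 ◇ majority 0x2670548193abc)
         (0x135029468 ◇ 0x147029358 ◇ 0x247135068 ◇ majority 0x7165023489abc))
        (0x034126589 ◇ 0x038126459 ◇ 0x039126458 ◇ 0x048126359 ◇ 0x789126345 ◇ 0x568034127 ◇
         0x168034257 ◇ 0x169034257 ◇ 0x245038167 ◇ 0x136048257 ◇ 0x029568134 ◇ 0x237568149 ◇
         cover 0x0716829453abc))))
     (0x048679123 ◇ 0x058679123 ◇ 0x458679123 ◇ 0x367458012 ◇ 0x379458012 ◇
      split 0x128abc
      (0x036128457 ◇ 0x039128457 ◇ 0x356128047 ◇ 0x359128047 ◇ 0x569128047 ◇ 0x346128057 ◇
       0x349128057 ◇ 0x469128057 ◇ 0x069128457 ◇ 0x478569123 ◇ 0x578469123 ◇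
       split 0x029abc
       (0x134029578 ◇ 0x135029478 ◇ 0x138029457 ◇ 0x146029578 ◇ 0x156029478 ◇ 0x167029458 ◇
        0x168029457 ◇ 0x257134069 ◇ 0x247135069 ◇ 0x248135069 ◇
        split 0x579abc
        (0x348579012 ◇ 0x016579248 ◇ 0x034579128 ◇ 0x015348679 ◇ 0x059348167 ◇ 0x157348069 ◇
         0x079348156 ◇ 0x279348156 ◇ 0x259348167 ◇ 0x789034156 ◇ 0x158034679 ◇ 0x178034569 ◇
         0x239015478 ◇ 0x269015478 ◇ 0x347059128 ◇ 0x467059128 ◇ 0x234789015 ◇ 0x018347269 ◇
         split 0x148abc
         (0x023148579 ◇ 0x357148029 ◇ 0x037148259 ◇ 0x056148279 ◇ 0x145023679 ◇ 0x249357016 ◇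
          0x068145279 ◇ mirror (cover 0x3618457920abc))
         (0x023148569 ◇ 0x256148039 ◇ 0x567148039 ◇ 0x067148239 ◇ 0x235148069 ◇ 0x145023789 ◇
          0x019256478 ◇ 0x238145069 ◇ mirror (majority 0x6943102758abc)))
        (0x014579368 ◇ 0x023579146 ◇ 0x034579168 ◇ 0x124579036 ◇ 0x038579146 ◇ 0x068579123 ◇
         0x468579123 ◇ 0x238579146 ◇ 0x234579168 ◇ 0x239014578 ◇ 0x269014578 ◇ 0x149023578 ◇
         0x126034578 ◇ 0x567034128 ◇ 0x129034578 ◇ 0x013468257 ◇ 0x016238457 ◇ 0x348126579 ◇
         split 0x568abc
         (0x347568012 ◇ 0x147568023 ◇ 0x015347269 ◇ 0x259347016 ◇ 0x678015234 ◇
          mirror (majority 0x1376928405abc))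
         (0x279568013 ◇ 0x479568013 ◇ 0x079568123 ◇ 0x015279348 ◇ 0x125479038 ◇ 0x678015239 ◇
          mirror (majority 0x1356908247abc))))
       (0x147029356 ◇ 0x148029356 ◇ 0x157029346 ◇ 0x158029346 ◇ 0x178029346 ◇
        split 0x257abc
        (0x169257048 ◇
         split 0x046abc
         (0x357046128 ◇ 0x579046128 ◇ 0x129046578 ◇ 0x138046257 ◇ 0x279046158 ◇ 0x259046178 ◇
          0x146357029 ◇ 0x124357069 ◇ 0x068579123 ◇ 0x026138579 ◇ 0x467138029 ◇ 0x567138029 ◇
          0x056279138 ◇ 0x067259138 ◇ 0x038146257 ◇ 0x089146257 ◇ 0x149068257 ◇ 0x589026147 ◇
          0x348026157 ◇ 0x459026178 ◇ 0x125038469 ◇ 0x127038469 ◇ mirror (cover 0x9306785124abc))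
         (0x579046123 ◇ 0x589046123 ◇ 0x789046123 ◇ 0x127046359 ◇ 0x348579012 ◇ 0x468579012 ◇
          0x126579048 ◇ 0x347589012 ◇ 0x467589012 ◇ 0x345789012 ◇ 0x027348169 ◇ 0x156348029 ◇
          0x167348029 ◇ 0x135468029 ◇ 0x079468123 ◇ 0x568347029 ◇ 0x089347126 ◇ 0x358467029 ◇
          0x678345029 ◇ 0x489156027 ◇ 0x267135048 ◇ 0x124568079 ◇ 0x035489126 ◇ 0x067489123 ◇
          majority 0x5817096342abc))
        (0x013257469 ◇ 0x016257349 ◇ 0x034257689 ◇ 0x149257036 ◇ 0x489257036 ◇ 0x038257469 ◇
         0x146257039 ◇ 0x049257368 ◇ 0x268013457 ◇ 0x289013457 ◇ 0x238016457 ◇ 0x126034578 ◇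
         0x567034128 ◇ 0x579034128 ◇ 0x129034578 ◇ 0x169034578 ◇ 0x023149578 ◇ 0x028567349 ◇
         0x124567039 ◇
         split 0x037abc
         (0x568037124 ◇ 0x589037124 ◇ 0x459037128 ◇ 0x258037146 ◇ 0x479568023 ◇ 0x067589123 ◇
          mirror (majority 0x9532678410abc))
         (0x459037126 ◇ 0x456037129 ◇ 0x258037169 ◇ 0x278459013 ◇ mirror (majority 0x3972648015abc)))))
      (0x034128679 ◇ 0x035128679 ◇ 0x046128379 ◇ 0x049128367 ◇ 0x056128379 ◇ 0x059128367 ◇
       0x345128679 ◇ 0x459128367 ◇ 0x456128379 ◇ 0x678345012 ◇ 0x789345012 ◇ 0x378459012 ◇
       split 0x017abc
       (0x236017458 ◇ 0x238017456 ◇ 0x268017345 ◇ 0x269017345 ◇ 0x289017345 ◇ 0x015236789 ◇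
        0x145236789 ◇
        split 0x138abc
        (0x026138457 ◇ 0x579138046 ◇ 0x569138047 ◇ 0x159026378 ◇ 0x468579123 ◇ 0x037569128 ◇
         0x037159468 ◇ ∎)
        (0x024138679 ◇ 0x025138679 ◇ 0x245138679 ◇
         split 0x469abc
         (0x357469012 ◇ 0x358469012 ◇ 0x578469012 ◇ 0x278469015 ◇ 0x258469017 ◇ 0x178469025 ◇
          0x127469035 ◇ 0x018357269 ◇ 0x069357128 ◇ 0x124357689 ◇ 0x146357289 ◇ 0x148357269 ◇
          0x147358269 ◇ 0x134578269 ◇ 0x257018469 ◇
          split 0x569abc
          (0x347569012 ◇ 0x348569012 ◇ 0x234569017 ◇ 0x027569134 ◇ 0x028569134 ◇ 0x078569124 ◇
           0x125347689 ◇ 0x158347269 ◇ 0x169347258 ◇ 0x157348269 ◇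
           split 0x349abc
           (0x567349012 ◇ 0x167349025 ◇ 0x068349125 ◇ 0x089567123 ◇ majority 0x0954163827abc)
           (0x026349178 ◇ 0x168349027 ◇ 0x126349078 ◇ 0x579026134 ◇ 0x079168245 ◇ 0x346579028 ◇
            majority 0x1046579823abc))
          (0x023569178 ◇ 0x027569138 ◇ 0x037569128 ◇ 0x078569123 ◇ 0x247569138 ◇ 0x579023146 ◇
           0x568023147 ◇ 0x135027469 ◇ 0x359027146 ◇ 0x125037469 ◇ 0x468579123 ◇ 0x349568127 ◇
           cover 0x4021375698abc))
         (0x027469138 ◇ 0x037469128 ◇ 0x578469123 ◇ 0x125469378 ◇ 0x357469128 ◇ 0x257469138 ◇
          0x157469238 ◇ 0x136027458 ◇ 0x139027456 ◇ 0x169027345 ◇ 0x189027345 ◇ 0x126037458 ◇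
          0x129037456 ◇ 0x346578012 ◇ 0x349578012 ◇ 0x468125037 ◇ 0x489125037 ◇ 0x567349128 ◇
          split 0x124abc
          (0x036124578 ◇ 0x568124037 ◇ 0x569124037 ◇ 0x589124037 ◇ 0x039124567 ◇ 0x069124357 ◇
           0x089124357 ◇ 0x127036489 ◇ 0x478036129 ◇ 0x347568129 ◇ 0x467589123 ◇
           split 0x156abc
           (0x023156478 ◇ 0x029156347 ◇ 0x278156034 ◇ 0x146023589 ◇ 0x159023468 ◇ 0x019278346 ◇
            majority 0x0174596238abc)
           (0x023156489 ◇ 0x028156349 ◇ 0x237156089 ◇ 0x148023567 ◇ 0x149023567 ◇ 0x137028456 ◇
            0x256148039 ◇ mirror (majority 0x9631852047abc)))
          (0x036124789 ◇ 0x038124679 ◇ 0x068124379 ◇ 0x069124378 ◇ 0x478036125 ◇ 0x479036125 ◇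
           0x148036257 ◇ 0x149036257 ◇ 0x248036157 ◇ 0x246038157 ◇ 0x347068125 ◇ 0x237068145 ◇
           0x019478236 ◇ 0x256478139 ◇ 0x159478236 ◇ 0x018479236 ◇ 0x028479136 ◇ 0x158479236 ◇
           cover 0x0519682734abc))))
       (0x234017689 ◇ 0x235017689 ◇ 0x246017389 ◇ 0x248017369 ◇ 0x256017389 ◇ 0x258017369 ◇
        split 0x067abc
        (0x134067258 ◇ 0x148067235 ◇ 0x149067235 ◇ 0x159067234 ◇ 0x589067234 ◇ 0x238067459 ◇
         0x359067248 ◇ 0x028134679 ◇ 0x014589367 ◇ 0x346589017 ◇ 0x267589134 ◇ 0x569238017 ◇
         0x145238679 ◇ 0x268359017 ◇ 0x278346059 ◇ majority 0x5462018937abc)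
        (0x489067123 ◇ 0x589067123 ◇ 0x349067128 ◇ 0x359067128 ◇ 0x356489012 ◇ 0x357489012 ◇
         0x567489012 ◇ 0x013489256 ◇ 0x126489035 ◇ 0x267489035 ◇ 0x346589012 ◇ 0x467589012 ◇
         0x018349256 ◇ 0x468359012 ◇ 0x289356017 ◇ 0x469357128 ◇ 0x089567123 ◇ 0x257013689 ◇
         0x015267389 ◇ 0x157289034 ◇ mirror (majority 0x1786354029abc))))))

  default : KVertex 13 3
  default = Vec.replicate 3 inside Vec.++ Vec.replicate 10 outside , refl

  rotation : Fin 13 → Fin 13
  -- A 10-cycle on the points outside the apex, fixing 10, 11 and 12.
  rotation = Vec.lookup (Vec.map (_mod 13) (1 ∷ 2 ∷ 3 ∷ 4 ∷ 5 ∷ 6 ∷ 7 ∷ 8 ∷ 9 ∷ 0 ∷ 10 ∷ 11 ∷ 12 ∷ []))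

  rotation-injective : Injective _≡_ _≡_ rotation
  rotation-injective {i} {j} =
    from-yes (allᶠ? λ i → allᶠ? λ j → (rotation i ≟ᶠ rotation j) →-dec (i ≟ᶠ j)) i j

  not-monoFree : (c : EdgeColouring 13 3) → ¬ MonoFree c
  not-monoFree c free = not-¬ {χ 0xabc 0x012} refl
    (clique-sound 0xabc 0x012 0x345 0x678 _ _ _ _ (sym first) (sym (trans first second)))
    where
      open Soundness default c free id id

      step : ∀ k → let module S = Soundness default c free
                         (power rotation k) (power-injective rotation-injective k) in
             S.χ 0xabc 0x012 ≡ S.χ 0xabc 0x123
      step k =
        equal-colours 0x012 0x123 refutation _ default c free
          (power rotation k) (power-injective rotation-injective k)

      -- Three unit rotations carry `012` to the disjoint triple `345`, and three more carry that to
      -- `678`.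
      first : χ 0xabc 0x012 ≡ χ 0xabc 0x345
      first = trans (step 0) (trans (step 1) (step 2))

      second : χ 0xabc 0x345 ≡ χ 0xabc 0x678
      second = trans (step 3) (trans (step 4) (step 5))

-- Monotonicity in the number of points.

extend : KVertex n r → KVertex (suc n) r
extend (s , p) = outside ∷ s , p

extend-adj : (u v : KVertex n r) → KAdj u v → KAdj (extend u) (extend v)
extend-adj u v adj (suc i) (Vec.there i∈u) (Vec.there i∈v) = adj i i∈u i∈v

restrict : EdgeColouring (suc n) r → EdgeColouring n r
restrict c .colour u v    = colour c (extend u) (extend v)
restrict c .symmetric u v = symmetric c (extend u) (extend v)

-- KG(n,r) sits inside KG(n+1,r) as the sets avoiding the new point, so a monochromatic triangle of
-- the restricted colouring is one of the whole.
Arrows33-suc : Arrows33 r n → Arrows33 r (suc n)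
Arrows33-suc arr c with arr (restrict c)
... | b , x , y , z , (xy , yz , xz) , mono =
  b , extend x , extend y , extend z ,
  (extend-adj x y xy , extend-adj y z yz , extend-adj x z xz) , mono

Arrows33-mono : ∀ {m} → n ≤′ m → Arrows33 r n → Arrows33 r m
Arrows33-mono ≤′-refl        arr = arr
Arrows33-mono (≤′-step n≤′m) arr = Arrows33-suc (Arrows33-mono n≤′m arr)

-- A colouring of KG(8,2) without monochromatic triangles.

meets : Subset n → Subset n → Bool
meets s t = not (∣ s ∩ t ∣ ≡ᵇ 0)

-- The points of KG(8,2) are ℤ/5 followed by three further points.
outer : Subset 8 → Subset 3
outer = Vec.drop 5

inner : Subset 8 → Bool
inner s = ∣ outer s ∣ ≡ᵇ 0

-- {i,x} points to i + 1 ∈ ℤ/5, a pair of outer points to the third one.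
target : Subset 8 → Subset 8
target (a ∷ b ∷ c ∷ d ∷ e ∷ xs) with ∣ xs ∣
... | 1 = e ∷ a ∷ b ∷ c ∷ d ∷ ∅
... | 2 = outside ∷ outside ∷ outside ∷ outside ∷ outside ∷ ∁ xs
... | _ = ∅

colouring₈ : EdgeColouring 8 2
colouring₈ .colour (s , _) (t , _) = inner s ∧ inner t ∨ meets (target s) t ∨ meets (target t) s
colouring₈ .symmetric (s , _) (t , _) =
  cong₂ _∨_ (∧-comm (inner s) (inner t)) (∨-comm (meets (target s) t) (meets (target t) s))

-- Verified by exhaustive search. By hand: mixed pairs {i,x}, {j,y} are joined in red iff i and j
-- are neighbours on the 5-cycle, so three of them are never monochromatic. Two inner pairs are
-- joined in red, while a disjoint mixed pair is red to exactly one of them and an outer pair to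
-- neither. An outer pair is red to a disjoint mixed pair but blue to an inner one. For {i,x}, {j,y}
-- and an inner pair P, all red would put i or j into P, and all blue would leave only one point for
-- P.
colouring₈-monoFree : MonoFree colouring₈
colouring₈-monoFree true  = from-no (monoTriangle? colouring₈ true)
colouring₈-monoFree false = from-no (monoTriangle? colouring₈ false)

¬Arrows33-2-8 : ¬ Arrows33 2 8
¬Arrows33-2-8 arr = let b , t = arr colouring₈ in colouring₈-monoFree b t

theorem1p12 : KneserRamsey33≡ 2 9 × KneserRamsey33≤ 3 13
theorem1p12 =
  (arrows KG₉₂.not-monoFree ,
   -- By monotonicity the case n = 8 rules out all smaller n.
   λ n n<9 arr → ¬Arrows33-2-8 (Arrows33-mono (≤⇒≤′ (s≤s⁻¹ n<9)) arr)) ,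
  (13 , ≤-refl , arrows KG₁₃₃.not-monoFree)
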